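{- There exists a sequence of finite graphs $G_n$ such that $\Delta(G_n)\to+\infty$ and $\mathrm{HG}(G_n)/\Delta(G_n)=4/3$ for every $n$.
   Context: All graphs are finite and simple; $\Delta(G)$ is the maximum degree of $G$. Hat guessing game: a sage sits at each vertex of $G$; an adversary gives each sage a hat whose color is one of $k$ colors $\{0,\dots,k-1\}$. Each sage sees the hat colors of his neighbours (not his own) and, according to a deterministic strategy fixed in advance (his guess is a function of the colors of his neighbours), guesses his own color; all guess simultaneously. The sages win if, for every assignment of colors, at least one sage guesses correctly. The hat guessing number $\mathrm{HG}(G)$ is the maximal $k$ for which the sages have a winning strategy. -}

module Defs where

open import Data.Nat using (ℕ; _≤_; _⊔_)
open import Data.Bool using (Bool; true; false)
open import Data.Fin using (Fin)
open import Data.List using (List; length; filter; map; foldr; allFin)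
open import Data.Product using (Σ; ∃; _×_)
open import Relation.Binary.PropositionalEquality using (_≡_)
open import Relation.Nullary using (¬_)
open import Data.Bool.Properties using (T?)
open import Data.Bool using (T)

record Graph : Set where
  field
    size  : ℕ
    adj   : Fin size → Fin size → Bool
    sym   : ∀ u v → adj u v ≡ adj v u
    irr   : ∀ v → adj v v ≡ false
open Graph public

degree : (G : Graph) → Fin (size G) → ℕ
degree G v = length (filter (λ u → T? (adj G v u)) (allFin (size G)))

Δ : Graph → ℕ
Δ G = foldr _⊔_ 0 (map (degree G) (allFin (size G)))

Colouring : Graph → ℕ → Set
Colouring G k = Fin (size G) → Fin k

record Strategy (G : Graph) (k : ℕ) : Set where
  field
    guess : Fin (size G) → Colouring G k → Fin k
    local : ∀ v (c c′ : Colouring G k) →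
            (∀ u → T (adj G v u) → c u ≡ c′ u) → guess v c ≡ guess v c′
open Strategy public

Wins : (G : Graph) (k : ℕ) → Strategy G k → Set
Wins G k s = ∀ (c : Colouring G k) → ∃ λ v → guess s v c ≡ c v

HatWinnable : Graph → ℕ → Set
HatWinnable G k = Σ (Strategy G k) (Wins G k)

IsHG : Graph → ℕ → Set
IsHG G h = HatWinnable G h × (∀ k → HatWinnable G k → k ≤ h)

{-# OPTIONS --safe #-}
module Submission where

-- Let p = 2m.  Take a clique of p "top" vertices, hang m "mid" vertices on each top so that
-- they form a clique of size m + 1 with it, and hang p "leaf" vertices on each mid so that
-- they form a clique of size p + 1 with it.  The largest degree, m + p = 3m, is that of a mid.
--
-- The sages win with 2p = 4m colours: tops and mids read a colour as a pair in Fin 2 × Fin p.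
-- On a clique whose vertices carry N₁, N₂, … colours with ∑ 1/Nᵢ = 1, some sage is right if
-- they split the residues of a weighted sum of the colours among themselves.  This applies to
-- a top's (or mid's) bit together with its children, and to the Fin p-components of the tops.
--
-- With k > 2p colours the adversary wins from the leaves upwards.  By averaging he can fix
-- the leaves below a mid so that more than half of the colours of the mid, hence p + 1 of
-- them, keep all those leaves wrong; then the mids, using p + 1 colours each, so that p + 1
-- colours of each top keep all its mids wrong; then the p tops, as p < p + 1.

open import Defs hiding (sym)
open import Data.Bool.Properties using (T?)
open import Data.Empty using (⊥)
open import Data.Fin using (Fin; zero; suc; toℕ; fromℕ<; combine; remQuot)
import Data.Fin.Properties as Fin
open import Data.List using (List; []; _∷_; _++_; length; lookup; map; filter; tabulate; allFin)
open import Data.List.Properties using (length-++; length-tabulate; length-map; foldr-preservesᵇ; foldr-preservesᵒ)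
open import Data.List.Membership.Propositional using (_∈_)
open import Data.List.Membership.Propositional.Properties
open import Data.List.Relation.Binary.Disjoint.Propositional using (Disjoint)
open import Data.List.Relation.Binary.Subset.Propositional using (_⊆_)
open import Data.List.Relation.Unary.All as All using (_∷_)
import Data.List.Relation.Unary.All.Properties as All
open import Data.List.Relation.Unary.Any as Any using (here; there; index)
import Data.List.Relation.Unary.Any.Properties as Any
open import Data.List.Relation.Unary.Unique.Propositional using (Unique; _∷_)
import Data.List.Relation.Unary.Unique.Propositional.Properties as Unique
open import Data.Nat
open import Data.Nat.DivMod
open import Data.Nat.Properties
open import Data.Nat.Tactic.RingSolver using (solve-∀)
open import Data.Product using (Σ; ∃; _×_; _,_; proj₁; proj₂)
open import Data.Product.Function.NonDependent.Propositional using (_×-↔_)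
open import Data.Sum using (_⊎_; inj₁; inj₂; [_,_]′)
open import Data.Sum.Function.Propositional using (_⊎-↔_)
open import Data.Vec.Functional using (removeAt) renaming ([] to []ᶠ; _∷_ to _∷ᶠ_)
open import Function using (_∘_; id; mk⇔)
open import Function.Bundles using (_↔_; Injection; Inverse)
open import Function.Construct.Composition using (_↔-∘_)
open import Function.Construct.Identity using (↔-id)
open import Function.Definitions using (Injective)
open import Function.Properties.Inverse using (↔-sym; ↔⇒↣)
open import Relation.Nullary using (Dec; does; yes; no; contradiction)
open import Relation.Nullary.Decidable using (⌊_⌋; isYes≗does; does-⇔; dec-false; toWitness; fromWitness)
open import Relation.Binary.PropositionalEquality
open import Algebra.Properties.CommutativeMonoid.Sum +-0-commutativeMonoid
  using (sum; sum-cong-≗; sum-remove; ∑-comm)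
open import Algebra.Properties.Semiring.Sum +-*-semiring using (*-distribˡ-sum)

-- Averaging over the colourings of a clique

sum-mono : ∀ {n} {f g : Fin n → ℕ} → (∀ i → f i ≤ g i) → sum f ≤ sum g
sum-mono {zero}  f≤g = z≤n
sum-mono {suc n} f≤g = +-mono-≤ (f≤g zero) (sum-mono (f≤g ∘ suc))

sum-const : ∀ n {m} → sum {n} (λ _ → m) ≡ n * m
sum-const zero    = refl
sum-const (suc n) = cong (_ +_) (sum-const n)

sum≡0⇒≡0 : ∀ {n} (f : Fin n → ℕ) → sum f ≡ 0 → ∀ i → f i ≡ 0
sum≡0⇒≡0 f ∑f≡0 zero    = m+n≡0⇒m≡0 _ ∑f≡0
sum≡0⇒≡0 f ∑f≡0 (suc i) = sum≡0⇒≡0 (f ∘ suc) (m+n≡0⇒n≡0 (f zero) ∑f≡0) i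

sum-≤-average : ∀ {n} .{{_ : NonZero n}} (f : Fin n → ℕ) → ∃ λ i → n * f i ≤ sum f
sum-≤-average {suc zero}    f = zero , ≤-refl
sum-≤-average {suc (suc n)} f with sum-≤-average (f ∘ suc)
... | i , below with ≤-total (f zero) (f (suc i))
...   | inj₁ f0≤fi = zero , +-monoʳ-≤ (f zero) (≤-trans (*-monoʳ-≤ (suc n) f0≤fi) below)
...   | inj₂ fi≤f0 = suc i , +-mono-≤ fi≤f0 below

module _ {s : ℕ} where

  -- The total over all `s ^ n` colourings, one coordinate at a time. It evaluates `f` only at
  -- functions built with `_∷ᶠ_`; function extensionality is avoided, since one such function below
  -- the average is all that the adversary needs.
  sumᶠ : ∀ {n} → ((Fin n → Fin s) → ℕ) → ℕ
  sumᶠ {zero}  f = f []ᶠ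
  sumᶠ {suc n} f = sum λ y → sumᶠ λ x → f (y ∷ᶠ x)

  sumᶠ-mono : ∀ {n} {f g : (Fin n → Fin s) → ℕ} → (∀ x → f x ≤ g x) → sumᶠ f ≤ sumᶠ g
  sumᶠ-mono {zero}  f≤g = f≤g _
  sumᶠ-mono {suc n} f≤g = sum-mono λ y → sumᶠ-mono λ x → f≤g (y ∷ᶠ x)

  sumᶠ-const : ∀ n {m} → sumᶠ {n} (λ _ → m) ≡ s ^ n * m
  sumᶠ-const zero        = sym (*-identityˡ _)
  sumᶠ-const (suc n) {m} = begin
    sum {s} (λ _ → sumᶠ {n} (λ _ → m)) ≡⟨ sum-const s ⟩
    s * sumᶠ {n} (λ _ → m)             ≡⟨ cong (s *_) (sumᶠ-const n) ⟩
    s * (s ^ n * m)                    ≡⟨ *-assoc s (s ^ n) m ⟨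
    s ^ suc n * m                      ∎
    where open ≡-Reasoning

  sumᶠ-sum-comm : ∀ {n k} (f : Fin k → (Fin n → Fin s) → ℕ) →
                  sumᶠ (λ x → sum λ c → f c x) ≡ sum λ c → sumᶠ (f c)
  sumᶠ-sum-comm {zero}  f = refl
  sumᶠ-sum-comm {suc n} f = trans
    (sum-cong-≗ λ y → sumᶠ-sum-comm λ c x → f c (y ∷ᶠ x))
    (∑-comm λ y c → sumᶠ λ x → f c (y ∷ᶠ x))

  -- Conditional expectations: fix the first coordinate so that the remaining total is at most
  -- average, then recurse on the others.
  sumᶠ-≤-average : ∀ {n} .{{_ : NonZero s}} (f : (Fin n → Fin s) → ℕ) →
                   ∃ λ x → s ^ n * f x ≤ sumᶠ f
  sumᶠ-≤-average {zero}  f = []ᶠ , ≤-reflexive (*-identityˡ _)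
  sumᶠ-≤-average {suc n} f
    with y , below ← sum-≤-average (λ y → sumᶠ λ x → f (y ∷ᶠ x))
    with x , below′ ← sumᶠ-≤-average (λ x → f (y ∷ᶠ x)) = y ∷ᶠ x , (begin
    s ^ suc n * f (y ∷ᶠ x)              ≡⟨ *-assoc s (s ^ n) _ ⟩
    s * (s ^ n * f (y ∷ᶠ x))            ≤⟨ *-monoʳ-≤ s below′ ⟩
    s * sumᶠ (λ x → f (y ∷ᶠ x))         ≤⟨ below ⟩
    sumᶠ f                             ∎)
    where open ≤-Reasoning

𝟙 : ∀ {A : Set} → Dec A → ℕ
𝟙 (yes _) = 1
𝟙 (no  _) = 0

sum-𝟙≤1 : ∀ {n} {P : Fin n → Set} (P? : ∀ i → Dec (P i)) →
          (∀ {i j} → P i → P j → i ≡ j) → sum (𝟙 ∘ P?) ≤ 1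
sum-𝟙≤1 {zero}  P? unique = z≤n
sum-𝟙≤1 {suc n} P? unique with P? zero
... | no  _  = sum-𝟙≤1 (P? ∘ suc) λ p q → Fin.suc-injective (unique p q)
... | yes p₀ = s≤s (≤-trans (sum-mono none) (≤-reflexive (trans (sum-const n) (*-zeroʳ n))))
  where
  none : ∀ i → 𝟙 (P? (suc i)) ≤ 0
  none i with P? (suc i)
  ... | yes p = contradiction (unique p₀ p) λ ()
  ... | no  _ = z≤n

AgreeOff : ∀ {n} {A : Set} → Fin n → (x x′ : Fin n → A) → Set
AgreeOff i x x′ = ∀ j → j ≢ i → x j ≡ x′ j

-- The other coordinates leave at most one value for coordinate `i`, so `P` has density at most
-- `1 / s`. The induction peels off the coordinates before `i`; at `i` itself the order of summation
-- is swapped so that `x i` is summed first.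
sumᶠ-𝟙≤ : ∀ {n s} (i : Fin n) {P : (Fin n → Fin s) → Set} (P? : ∀ x → Dec (P x)) →
          (∀ {x x′} → AgreeOff i x x′ → P x → P x′ → x i ≡ x′ i) →
          s * sumᶠ (𝟙 ∘ P?) ≤ s ^ n
sumᶠ-𝟙≤ {suc n} {s} zero P? unique = *-monoʳ-≤ s (begin
  sum (λ y → sumᶠ λ x → 𝟙 (P? (y ∷ᶠ x)))  ≡⟨ sumᶠ-sum-comm (λ y x → 𝟙 (P? (y ∷ᶠ x))) ⟨
  sumᶠ (λ x → sum λ y → 𝟙 (P? (y ∷ᶠ x)))  ≤⟨ sumᶠ-mono (λ x → sum-𝟙≤1 (λ y → P? (y ∷ᶠ x)) λ p q → unique (same x) p q) ⟩
  sumᶠ {n = n} (λ _ → 1)                 ≡⟨ sumᶠ-const n ⟩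
  s ^ n * 1                              ≡⟨ *-identityʳ _ ⟩
  s ^ n                                  ∎)
  where
  open ≤-Reasoning
  same : ∀ (x : Fin n → Fin s) {y y′} → AgreeOff zero (y ∷ᶠ x) (y′ ∷ᶠ x)
  same x zero    0≢0 = contradiction refl 0≢0
  same x (suc j) _   = refl
sumᶠ-𝟙≤ {suc n} {s} (suc i) P? unique = begin
  s * sum (λ y → sumᶠ λ x → 𝟙 (P? (y ∷ᶠ x)))    ≡⟨ *-distribˡ-sum s (λ y → sumᶠ λ x → 𝟙 (P? (y ∷ᶠ x))) ⟩
  sum (λ y → s * sumᶠ (λ x → 𝟙 (P? (y ∷ᶠ x))))  ≤⟨ sum-mono (λ y → sumᶠ-𝟙≤ i (λ x → P? (y ∷ᶠ x)) (unique ∘ extend y)) ⟩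
  sum {s} (λ _ → s ^ n)                        ≡⟨ sum-const s ⟩
  s ^ suc n                                    ∎
  where
  open ≤-Reasoning
  extend : ∀ y {x x′ : Fin n → Fin s} → AgreeOff i x x′ → AgreeOff (suc i) (y ∷ᶠ x) (y ∷ᶠ x′)
  extend y x≈x′ zero    _   = refl
  extend y x≈x′ (suc j) j≢i = x≈x′ j (j≢i ∘ cong suc)

-- Each index with a nonzero value adds at least 1 to the sum, so at most `sum f` of the `k` indices
-- are lost.
select-zeros : ∀ {k} r (f : Fin k → ℕ) → r + sum f ≤ k →
               ∃ λ (e : Fin r → Fin k) → Injective _≡_ _≡_ e × (∀ a → f (e a) ≡ 0)
select-zeros         zero    f _ = (λ ()) , (λ {}) , λ ()
select-zeros {suc k} (suc r) f (s≤s r+∑f≤k) with f zero in f0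
... | zero  with e , e-inj , zeros ← select-zeros r (f ∘ suc) r+∑f≤k =
  zero ∷ᶠ suc ∘ e , inj , λ { zero → f0 ; (suc a) → zeros a }
  where
  inj : Injective _≡_ _≡_ (zero ∷ᶠ suc ∘ e)
  inj {zero}  {zero}  _  = refl
  inj {suc a} {suc b} eq = cong suc (e-inj (Fin.suc-injective eq))
-- The skipped index is paid for by its own value: dropping `suc v` lowers the sum by at least one.
... | suc v with e , e-inj , zeros ← select-zeros (suc r) (f ∘ suc)
                   (≤-trans (s≤s (+-monoʳ-≤ r (m≤n+m _ v))) (subst (_≤ k) (+-suc r _) r+∑f≤k)) =
  suc ∘ e , e-inj ∘ Fin.suc-injective , zeros

-- By averaging, some x has at most k n / s pairs (c , i) at which g is correct.
-- Abstract, since unfolding the search for x makes the later conversion checks explode.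
abstract
  avoid-clique :
    ∀ {k n s q} .{{_ : NonZero s}} r →
    (∀ f → s * f ≤ k * n → r + f ≤ k) →
    (palette : Fin n → Fin s → Fin q) → (∀ i → Injective _≡_ _≡_ (palette i)) →
    (g : Fin k → Fin n → (Fin n → Fin s) → Fin q) →
    (∀ c i {x x′} → AgreeOff i x x′ → g c i x ≡ g c i x′) →
    ∃ λ x → ∃ λ (e : Fin r → Fin k) →
      Injective _≡_ _≡_ e × (∀ a i → g (e a) i x ≢ palette i (x i))
  avoid-clique {k} {n} {s} r enough palette palette-inj g g-local
    = let x , below = average
          e , e-inj , zeros = select-zeros r (λ c → sum λ i → 𝟙 (hit? c i x)) (enough _ below)
      in x , e , e-inj , λ a i → 𝟙≡0 _ (sum≡0⇒≡0 _ (zeros a) i)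
    where
    open ≤-Reasoning
    hit? : ∀ c i x → Dec (g c i x ≡ palette i (x i))
    hit? c i x = g c i x Fin.≟ palette i (x i)
    hits : (Fin n → Fin s) → ℕ
    hits x = sum λ c → sum λ i → 𝟙 (hit? c i x)

    𝟙≡0 : ∀ {A : Set} (A? : Dec A) → 𝟙 A? ≡ 0 → A → ⊥
    𝟙≡0 (no ¬a) _ a = ¬a a

    -- Sage `i` guesses without seeing `x i`, and `palette i` is injective, so a correct guess
    -- determines `x i` from the other coordinates.
    column : ∀ c i → s * sumᶠ (λ x → 𝟙 (hit? c i x)) ≤ s ^ n
    column c i = sumᶠ-𝟙≤ i (hit? c i) λ x≈x′ h h′ →
      palette-inj i (trans (sym h) (trans (g-local c i x≈x′) h′))

    total : s * sumᶠ hits ≤ k * n * s ^ n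
    total = begin
      s * sumᶠ hits                                              ≡⟨ cong (s *_) (sumᶠ-sum-comm λ c x → sum λ i → 𝟙 (hit? c i x)) ⟩
      s * sum (λ c → sumᶠ λ x → sum λ i → 𝟙 (hit? c i x))        ≡⟨ cong (s *_) (sum-cong-≗ λ c → sumᶠ-sum-comm λ i x → 𝟙 (hit? c i x)) ⟩
      s * sum (λ c → sum λ i → sumᶠ λ x → 𝟙 (hit? c i x))        ≡⟨ *-distribˡ-sum s (λ c → sum λ i → sumᶠ λ x → 𝟙 (hit? c i x)) ⟩
      sum (λ c → s * sum λ i → sumᶠ λ x → 𝟙 (hit? c i x))        ≡⟨ sum-cong-≗ (λ c → *-distribˡ-sum s λ i → sumᶠ λ x → 𝟙 (hit? c i x)) ⟩
      sum (λ c → sum λ i → s * sumᶠ λ x → 𝟙 (hit? c i x))        ≤⟨ sum-mono (λ c → sum-mono (column c)) ⟩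
      sum {k} (λ _ → sum {n} λ _ → s ^ n)                        ≡⟨ sum-const k ⟩
      k * sum {n} (λ _ → s ^ n)                                  ≡⟨ cong (k *_) (sum-const n) ⟩
      k * (n * s ^ n)                                            ≡⟨ *-assoc k n (s ^ n) ⟨
      k * n * s ^ n                                              ∎

    -- Double counting gave the total over all `x`; take an `x` at or below the average and cancel
    -- `s ^ n`.
    average : ∃ λ x → s * hits x ≤ k * n
    average with x , below ← sumᶠ-≤-average hits =
      x , *-cancelʳ-≤ (s * hits x) (k * n) (s ^ n) {{m^n≢0 s n}} (begin
      s * hits x * s ^ n     ≡⟨ *-assoc s (hits x) (s ^ n) ⟩
      s * (hits x * s ^ n)   ≡⟨ cong (s *_) (*-comm (hits x) (s ^ n)) ⟩
      s * (s ^ n * hits x)   ≤⟨ *-monoʳ-≤ s below ⟩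
      s * sumᶠ hits          ≤⟨ total ⟩
      k * n * s ^ n          ∎)

-- The graph and the adversary

-- Supplies the counting hypothesis of `avoid-clique`: the number `f` of hits is at most
-- `k n / s < k / 2`, so more than `k / 2 > p` of the root's colours survive.
more-than-half : ∀ {k n s p} → 2 * n < s → 2 * p < k →
                 ∀ f → s * f ≤ k * n → suc p + f ≤ k
more-than-half {k} {n} {s} {p} 2n<s 2p<k f sf≤kn = *-cancelˡ-< 2 (p + f) k (begin-strict
  2 * (p + f)      ≡⟨ *-distribˡ-+ 2 p f ⟩
  2 * p + 2 * f    <⟨ +-mono-< 2p<k 2f<k ⟩
  k + k            ≡⟨ cong (k +_) (+-identityʳ k) ⟨
  2 * k            ∎)
  where
  open ≤-Reasoning
  x*2y : ∀ x y → x * (2 * y) ≡ 2 * (x * y)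
  x*2y x y = trans (sym (*-assoc x 2 y)) (trans (cong (_* y) (*-comm x 2)) (*-assoc 2 x y))
  2f<k : 2 * f < k
  2f<k = *-cancelˡ-< s (2 * f) k (begin-strict
    s * (2 * f)    ≡⟨ x*2y s f ⟩
    2 * (s * f)    ≤⟨ *-monoʳ-≤ 2 sf≤kn ⟩
    2 * (k * n)    ≡⟨ x*2y k n ⟨
    k * (2 * n)    <⟨ *-monoʳ-< k {{>-nonZero (≤-<-trans z≤n 2p<k)}} 2n<s ⟩
    k * s          ≡⟨ *-comm k s ⟩
    s * k          ∎)

module CliqueTree (m : ℕ) where

  p : ℕ
  p = 2 * m

  Vertex : Set
  Vertex = Fin p ⊎ (Fin p × Fin m) ⊎ (Fin p × Fin m × Fin p)

  pattern top t      = inj₁ t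
  pattern mid t i    = inj₂ (inj₁ (t , i))
  pattern leaf t i j = inj₂ (inj₂ (t , i , j))

  infix 4 _~_
  -- Inductive, so that locality is proved by matching on the kinds of edge at a vertex.
  data _~_ : Vertex → Vertex → Set where
    top-top   : ∀ {t t′} → t ≢ t′ → top t ~ top t′
    top-mid   : ∀ {t i} → top t ~ mid t i
    mid-top   : ∀ {t i} → mid t i ~ top t
    mid-mid   : ∀ {t i i′} → i ≢ i′ → mid t i ~ mid t i′
    mid-leaf  : ∀ {t i j} → mid t i ~ leaf t i j
    leaf-mid  : ∀ {t i j} → leaf t i j ~ mid t i
    leaf-leaf : ∀ {t i j j′} → j ≢ j′ → leaf t i j ~ leaf t i j′

  ~-sym : ∀ {u v} → u ~ v → v ~ u
  ~-sym (top-top t≢t′)   = top-top (t≢t′ ∘ sym)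
  ~-sym top-mid          = mid-top
  ~-sym mid-top          = top-mid
  ~-sym (mid-mid i≢i′)   = mid-mid (i≢i′ ∘ sym)
  ~-sym mid-leaf         = leaf-mid
  ~-sym leaf-mid         = mid-leaf
  ~-sym (leaf-leaf j≢j′) = leaf-leaf (j≢j′ ∘ sym)

  ~-irrefl : ∀ {v} → v ~ v → ⊥
  ~-irrefl (top-top t≢t)   = t≢t refl
  ~-irrefl (mid-mid i≢i)   = i≢i refl
  ~-irrefl (leaf-leaf j≢j) = j≢j refl

  _~?_ : ∀ u v → Dec (u ~ v)
  top t ~? top t′ with t Fin.≟ t′
  ... | yes refl = no ~-irrefl
  ... | no t≢t′  = yes (top-top t≢t′)
  top t ~? mid t′ i with t Fin.≟ t′
  ... | yes refl = yes top-mid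
  ... | no t≢t′  = no λ { top-mid → t≢t′ refl }
  top _ ~? leaf _ _ _ = no λ ()
  mid t i ~? top t′ with t Fin.≟ t′
  ... | yes refl = yes mid-top
  ... | no t≢t′  = no λ { mid-top → t≢t′ refl }
  mid t i ~? mid t′ i′ with t Fin.≟ t′ | i Fin.≟ i′
  ... | no t≢t′  | _        = no λ { (mid-mid _) → t≢t′ refl }
  ... | yes refl | yes refl = no ~-irrefl
  ... | yes refl | no i≢i′  = yes (mid-mid i≢i′)
  mid t i ~? leaf t′ i′ j with t Fin.≟ t′ | i Fin.≟ i′
  ... | no t≢t′  | _        = no λ { mid-leaf → t≢t′ refl }
  ... | yes refl | no i≢i′  = no λ { mid-leaf → i≢i′ refl }
  ... | yes refl | yes refl = yes mid-leaf
  leaf _ _ _ ~? top _ = no λ ()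
  leaf t i j ~? mid t′ i′ with t Fin.≟ t′ | i Fin.≟ i′
  ... | no t≢t′  | _        = no λ { leaf-mid → t≢t′ refl }
  ... | yes refl | no i≢i′  = no λ { leaf-mid → i≢i′ refl }
  ... | yes refl | yes refl = yes leaf-mid
  leaf t i j ~? leaf t′ i′ j′ with t Fin.≟ t′ | i Fin.≟ i′ | j Fin.≟ j′
  ... | no t≢t′  | _        | _        = no λ { (leaf-leaf _) → t≢t′ refl }
  ... | yes refl | no i≢i′  | _        = no λ { (leaf-leaf _) → i≢i′ refl }
  ... | yes refl | yes refl | yes refl = no ~-irrefl
  ... | yes refl | yes refl | no j≢j′  = yes (leaf-leaf j≢j′)

  Local : ∀ {k} → (Vertex → (Vertex → Fin k) → Fin k) → Set
  Local g = ∀ v {c c′} → (∀ u → v ~ u → c u ≡ c′ u) → g v c ≡ g v c′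

  module Adversary {k} (2p<k : 2 * p < k) (g : Vertex → (Vertex → Fin k) → Fin k)
                   (g-local : Local g) where

    instance
      k≢0 : NonZero k
      k≢0 = >-nonZero (≤-<-trans z≤n 2p<k)

    -- Leaves only see their own copy, so the colouring can be repeated on all copies.
    withLeaves : (Fin p → Fin k) → Fin k → Vertex → Fin k
    withLeaves x c (top _)      = c
    withLeaves x c (mid _ _)    = c
    withLeaves x c (leaf _ _ j) = x j

    avoid-leaves : ∀ t i → ∃ λ x → ∃ λ (e : Fin (suc p) → Fin k) → Injective _≡_ _≡_ e ×
                   (∀ a j → g (leaf t i j) (withLeaves x (e a)) ≢ x j)
    -- Leaves may use all `k` colours, hence the identity palette; `2p<k` serves both as the bound
    -- on the `p` leaves and as the bound on the colours of the mid.
    avoid-leaves t i = avoid-clique (suc p) (more-than-half 2p<k 2p<k)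
      (λ _ → id) (λ _ → id) (λ c j x → g (leaf t i j) (withLeaves x c))
      λ c j x≈x′ → g-local (leaf t i j) λ
        { _ leaf-mid → refl ; _ (leaf-leaf j≢j′) → x≈x′ _ (j≢j′ ∘ sym) }

    leafColour : ∀ t i → Fin p → Fin k
    leafColour t i = proj₁ (avoid-leaves t i)

    midPalette : ∀ t i → Fin (suc p) → Fin k
    midPalette t i = proj₁ (proj₂ (avoid-leaves t i))

    -- The pattern chosen below `t` is again repeated below every top: a mid sees nothing below the
    -- other tops.
    withMids : (t : Fin p) → (Fin m → Fin (suc p)) → Fin k → Vertex → Fin k
    withMids t y c (top _)      = c
    withMids t y c (mid _ i)    = midPalette t i (y i)
    withMids t y c (leaf _ i j) = leafColour t i j

    avoid-mids : ∀ t → ∃ λ y → ∃ λ (e : Fin (suc p) → Fin k) → Injective _≡_ _≡_ e ×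
                 (∀ a i → g (mid t i) (withMids t y (e a)) ≢ midPalette t i (y i))
    -- Here `≤-refl` proves `2 * m < suc p`. This is what `p = 2 * m` is for: with `p + 1` colours
    -- each, `m` mids spoil fewer than half of the colours of their top.
    avoid-mids t = avoid-clique (suc p) (more-than-half ≤-refl 2p<k)
      (midPalette t) (λ i → proj₁ (proj₂ (proj₂ (avoid-leaves t i))))
      (λ c i y → g (mid t i) (withMids t y c))
      λ c i y≈y′ → g-local (mid t i) λ
        { _ mid-top → refl
        ; _ (mid-mid i≢i′) → cong (midPalette t _) (y≈y′ _ (i≢i′ ∘ sym))
        ; _ mid-leaf → refl }

    midColour : ∀ t → Fin m → Fin k
    midColour t i = midPalette t i (proj₁ (avoid-mids t) i)

    topPalette : ∀ t → Fin (suc p) → Fin k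
    topPalette t = proj₁ (proj₂ (avoid-mids t))

    withTops : (Fin p → Fin (suc p)) → Vertex → Fin k
    withTops z (top t)      = topPalette t (z t)
    withTops z (mid t i)    = midColour t i
    withTops z (leaf t i j) = leafColour t i j

    avoid-tops : ∃ λ z → ∀ t → g (top t) (withTops z) ≢ topPalette t (z t)
    avoid-tops =
      -- Nothing hangs above the tops, so the root is a dummy with one colour. The `p` tops have
      -- `p + 1` colours each, hence fewer than one hit on average, and some `z` has none.
      let z , _ , _ , avoids = avoid-clique {k = 1} 1 enough
            topPalette (λ t → proj₁ (proj₂ (proj₂ (avoid-mids t))))
            (λ _ t z → g (top t) (withTops z))
            λ _ t z≈z′ → g-local (top t) λ
              { _ (top-top t≢t′) → cong (topPalette _) (z≈z′ _ (t≢t′ ∘ sym))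
              ; _ top-mid → refl }
      in z , avoids zero
      where
      enough : ∀ f → suc p * f ≤ 1 * p → 1 + f ≤ 1
      enough zero    _  = ≤-refl
      enough (suc f) le = contradiction
        (≤-trans (m≤m*n (suc p) (suc f)) (≤-trans le (≤-reflexive (*-identityˡ p)))) 1+n≰n

    colouring : Vertex → Fin k
    colouring = withTops (proj₁ avoid-tops)

    -- Each avoidance result concerns a colouring repeated over all copies. It agrees with
    -- `colouring` on what the sage sees, once the free colour is taken to be the one later chosen
    -- for the parent, so locality transfers the wrong guess.
    no-correct-guess : ∀ v → g v colouring ≢ colouring v
    no-correct-guess (top t)      = proj₂ avoid-tops t
    no-correct-guess (mid t i)    = proj₂ (proj₂ (proj₂ (avoid-mids t))) (proj₁ avoid-tops t) i ∘ trans
      (g-local (mid t i) λ { _ mid-top → refl ; _ (mid-mid _) → refl ; _ mid-leaf → refl })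
    no-correct-guess (leaf t i j) = proj₂ (proj₂ (proj₂ (avoid-leaves t i))) (proj₁ (avoid-mids t) i) j ∘ trans
      (g-local (leaf t i j) λ { _ leaf-mid → refl ; _ (leaf-leaf _) → refl })

-- The sages' strategy

-- The unique y with y + r ≡ t (mod N); multiplying r by N - 1 negates it.
complement : ∀ N .{{_ : NonZero N}} → ℕ → ℕ → Fin N
complement N t r = (t + pred N * r) mod N

complement-correct : ∀ N .{{_ : NonZero N}} (y : Fin N) {t r} → (toℕ y + r) % N ≡ t →
                     complement N t r ≡ y
complement-correct N@(suc N-1) y {t} {r} refl = Fin.toℕ-injective (begin
  toℕ (complement N t r)                     ≡⟨ Fin.toℕ-fromℕ< _ ⟩
  ((toℕ y + r) % N + N-1 * r) % N            ≡⟨ %-distribˡ-+ ((toℕ y + r) % N) (N-1 * r) N ⟩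
  ((toℕ y + r) % N % N + N-1 * r % N) % N    ≡⟨ cong (λ z → (z + N-1 * r % N) % N) (m%n%n≡m%n (toℕ y + r) N) ⟩
  ((toℕ y + r) % N + N-1 * r % N) % N        ≡⟨ %-distribˡ-+ (toℕ y + r) (N-1 * r) N ⟨
  (toℕ y + r + N-1 * r) % N                  ≡⟨ cong (_% N) (regroup (toℕ y) r N-1) ⟩
  (toℕ y + r * N) % N                        ≡⟨ [m+kn]%n≡m%n (toℕ y) r N ⟩
  toℕ y % N                                  ≡⟨ m<n⇒m%n≡m (Fin.toℕ<n y) ⟩
  toℕ y                                      ∎)
  where
  open ≡-Reasoning
  regroup : ∀ y r n → y + r + n * r ≡ y + r * suc n
  regroup = solve-∀

sumOff : ∀ {n} → Fin n → (Fin n → ℕ) → ℕ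
sumOff {suc n} i f = sum (removeAt f i)

sum-off : ∀ {n} (i : Fin n) f → sum f ≡ f i + sumOff i f
sum-off {suc n} i f = sum-remove {i = i} f

sumOff-cong : ∀ {n} (i : Fin n) {f g} → AgreeOff i f g → sumOff i f ≡ sumOff i g
sumOff-cong {suc n} i f≈g = sum-cong-≗ λ j → f≈g _ (Fin.punchInᵢ≢i i j)

module _ (n : ℕ) .{{_ : NonZero n}} where

  private instance
    2n≢0 : NonZero (2 * n)
    2n≢0 = m*n≢0 2 n

  -- In the clique of a root with bit a and n children coloured by x, the root bets that
  -- ∑ x + n a is below n modulo 2n, and child i bets that it is n + i.
  rootFromSum : ℕ → Fin 2
  rootFromSum r with r % (2 * n) <? n
  ... | yes _ = zero
  ... | no  _ = suc zero

  rootGuess : (Fin n → Fin (2 * n)) → Fin 2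
  rootGuess x = rootFromSum (sum (toℕ ∘ x))

  rootGuess-cong : ∀ {x x′} → x ≗ x′ → rootGuess x ≡ rootGuess x′
  rootGuess-cong x≗x′ = cong rootFromSum (sum-cong-≗ (cong toℕ ∘ x≗x′))

  childGuess : Fin n → Fin 2 → (Fin n → Fin (2 * n)) → Fin (2 * n)
  childGuess i a x = complement (2 * n) (n + toℕ i) (sumOff i (toℕ ∘ x) + n * toℕ a)

  childGuess-cong : ∀ i {a a′ x x′} → a ≡ a′ → AgreeOff i x x′ →
                    childGuess i a x ≡ childGuess i a′ x′
  childGuess-cong i {a} refl x≈x′ = cong (λ r → complement (2 * n) (n + toℕ i) (r + n * toℕ a))
    (sumOff-cong i λ j j≢i → cong toℕ (x≈x′ j j≢i))

  -- Adding `n` modulo `2 * n` swaps the lower and upper halves of the residues, so only one bit `a`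
  -- brings `r + n a` into the lower half.
  rootFromSum-correct : ∀ r a → (r + n * toℕ a) % (2 * n) < n → rootFromSum r ≡ a
  rootFromSum-correct r a small with r % (2 * n) <? n
  rootFromSum-correct r zero       small | yes _ = refl
  rootFromSum-correct r (suc zero) small | no  _ = refl
  rootFromSum-correct r zero       small | no ≮n = contradiction
    (subst (λ z → z % (2 * n) < n) (trans (cong (r +_) (*-zeroʳ n)) (+-identityʳ r)) small) ≮n
  -- Since `q < n`, adding `n` does not wrap around, and the residue `q + n` lies in the upper half.
  rootFromSum-correct r (suc zero) small | yes q<n = contradiction small (≤⇒≯ (begin
    n                                    ≤⟨ m≤n+m n q ⟩
    q + n                                ≡⟨ m<n⇒m%n≡m q+n<2n ⟨
    (q + n) % (2 * n)                    ≡⟨ cong (λ z → (q + z) % (2 * n)) (m<n⇒m%n≡m n<2n) ⟨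
    (q + n % (2 * n)) % (2 * n)          ≡⟨ %-distribˡ-+ r n (2 * n) ⟨
    (r + n) % (2 * n)                    ≡⟨ cong (λ z → (r + z) % (2 * n)) (*-identityʳ n) ⟨
    (r + n * 1) % (2 * n)                ∎))
    where
    open ≤-Reasoning
    q = r % (2 * n)
    q+n<2n : q + n < 2 * n
    q+n<2n = subst (q + n <_) (cong (n +_) (sym (+-identityʳ n))) (+-monoˡ-< n q<n)
    n<2n : n < 2 * n
    n<2n = ≤-<-trans (m≤n+m n q) q+n<2n

  root-or-child : ∀ a x → rootGuess x ≡ a ⊎ ∃ λ i → childGuess i a x ≡ x i
  root-or-child a x with (sum (toℕ ∘ x) + n * toℕ a) % (2 * n) in eq
  ... | s with s <? n
  ...   | yes s<n = inj₁ (rootFromSum-correct _ a (subst (_< n) (sym eq) s<n))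
  ...   | no  s≮n = inj₂ (i , complement-correct (2 * n) (x i) (begin
    (toℕ (x i) + (sumOff i (toℕ ∘ x) + n * toℕ a)) % (2 * n)  ≡⟨ cong (_% (2 * n)) (+-assoc (toℕ (x i)) _ _) ⟨
    (toℕ (x i) + sumOff i (toℕ ∘ x) + n * toℕ a) % (2 * n)    ≡⟨ cong (λ z → (z + n * toℕ a) % (2 * n)) (sum-off i (toℕ ∘ x)) ⟨
    (sum (toℕ ∘ x) + n * toℕ a) % (2 * n)                     ≡⟨ eq ⟩
    s                                                         ≡⟨ m+[n∸m]≡n (≮⇒≥ s≮n) ⟨
    n + (s ∸ n)                                               ≡⟨ cong (n +_) (Fin.toℕ-fromℕ< _) ⟨
    n + toℕ i                                                 ∎))
    where
    open ≡-Reasoning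
    s<2n : s < n + n
    s<2n = subst₂ _<_ eq (cong (n +_) (+-identityʳ n)) (m%n<n _ (2 * n))
    i : Fin n
    i = fromℕ< (+-cancelˡ-< n (s ∸ n) n (subst (_< n + n) (sym (m+[n∸m]≡n (≮⇒≥ s≮n))) s<2n))

-- The classical strategy on a complete graph: sage `i` bets that all colours add up to `i` modulo
-- `N`.
cliqueGuess : ∀ N .{{_ : NonZero N}} → Fin N → (Fin N → Fin N) → Fin N
cliqueGuess N i x = complement N (toℕ i) (sumOff i (toℕ ∘ x))

cliqueGuess-cong : ∀ N .{{_ : NonZero N}} i {x x′} → AgreeOff i x x′ →
                   cliqueGuess N i x ≡ cliqueGuess N i x′
cliqueGuess-cong N i x≈x′ =
  cong (complement N (toℕ i)) (sumOff-cong i λ j j≢i → cong toℕ (x≈x′ j j≢i))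

cliqueGuess-wins : ∀ N .{{_ : NonZero N}} x → ∃ λ i → cliqueGuess N i x ≡ x i
cliqueGuess-wins N x = i , complement-correct N (x i)
  (trans (cong (_% N) (sym (sum-off i (toℕ ∘ x)))) (sym (Fin.toℕ-fromℕ< _)))
  where
  i : Fin N
  i = sum (toℕ ∘ x) mod N

module Sages (m : ℕ) .{{_ : NonZero m}} where
  open CliqueTree m

  private instance
    p≢0 : NonZero p
    p≢0 = m*n≢0 2 m

  high : Fin (2 * p) → Fin 2
  high = proj₁ ∘ remQuot p

  low : Fin (2 * p) → Fin p
  low = proj₂ ∘ remQuot {2} p

  -- A top or mid plays two games at once: its high part as the root of the clique below, its low
  -- part among its siblings. The low part lies in `Fin (2 * m)`, just what a child in a clique with
  -- `m` children needs; a leaf, one of `p` children, uses its whole colour in `Fin (2 * p)`.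
  guessV : Vertex → (Vertex → Fin (2 * p)) → Fin (2 * p)
  guessV (top t) c = combine
    (rootGuess m λ i → low (c (mid t i)))
    (cliqueGuess p t λ t′ → low (c (top t′)))
  guessV (mid t i) c = combine
    (rootGuess p λ j → c (leaf t i j))
    (childGuess m i (high (c (top t))) λ i′ → low (c (mid t i′)))
  guessV (leaf t i j) c = childGuess p j (high (c (mid t i))) λ j′ → c (leaf t i j′)

  guessV-local : Local guessV
  guessV-local (top t) c≈c′ = cong₂ combine
    (rootGuess-cong m λ i → cong low (c≈c′ _ top-mid))
    (cliqueGuess-cong p t λ t′ t′≢t → cong low (c≈c′ _ (top-top (t′≢t ∘ sym))))
  guessV-local (mid t i) c≈c′ = cong₂ combine
    (rootGuess-cong p λ j → c≈c′ _ mid-leaf)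
    (childGuess-cong m i (cong high (c≈c′ _ mid-top))
      λ i′ i′≢i → cong low (c≈c′ _ (mid-mid (i′≢i ∘ sym))))
  guessV-local (leaf t i j) c≈c′ = childGuess-cong p j (cong high (c≈c′ _ leaf-mid))
    λ j′ j′≢j → c≈c′ _ (leaf-leaf (j′≢j ∘ sym))

  combine-high-low : ∀ {a b} c → a ≡ high c → b ≡ low c → combine a b ≡ c
  combine-high-low c refl refl = Fin.combine-remQuot {2} p c

  -- Descend along sages whose low part is right. If the high part is wrong, some child is right in
  -- the clique below; the descent ends at a leaf at the latest, where nothing more has to be right.
  guessV-wins : ∀ c → ∃ λ v → guessV v c ≡ c v
  guessV-wins c
    with t , t✓ ← cliqueGuess-wins p (λ t → low (c (top t)))
    with root-or-child m (high (c (top t))) (λ i → low (c (mid t i)))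
  ... | inj₁ high✓ = top t , combine-high-low _ high✓ t✓
  ... | inj₂ (i , i✓) with root-or-child p (high (c (mid t i))) (λ j → c (leaf t i j))
  ...   | inj₁ high✓    = mid t i , combine-high-low _ high✓ i✓
  ...   | inj₂ (j , j✓) = leaf t i j , j✓

-- Maximum degree

module _ {A : Set} where

  Unique⇒lookup-injective : {xs : List A} → Unique xs → Injective _≡_ _≡_ (lookup xs)
  Unique⇒lookup-injective (_  ∷ _)  {zero}  {zero}  _  = refl
  Unique⇒lookup-injective (x∉ ∷ _)  {zero}  {suc j} eq = contradiction eq (All.lookup x∉ (∈-lookup j))
  Unique⇒lookup-injective (x∉ ∷ _)  {suc i} {zero}  eq = contradiction (sym eq) (All.lookup x∉ (∈-lookup i))
  Unique⇒lookup-injective (_  ∷ xs!) {suc i} {suc j} eq = cong suc (Unique⇒lookup-injective xs! eq)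

  -- Sending each entry of `xs` to a position of it in `ys` is injective, because looking up that
  -- position recovers the entry.
  Unique-⊆⇒length≤ : {xs ys : List A} → Unique xs → xs ⊆ ys → length xs ≤ length ys
  Unique-⊆⇒length≤ {xs} {ys} xs! xs⊆ys = Fin.injective⇒≤ {f = position} λ {i} {j} eq →
    Unique⇒lookup-injective xs! (begin
      lookup xs i             ≡⟨ Any.lookup-index (xs⊆ys (∈-lookup i)) ⟩
      lookup ys (position i)  ≡⟨ cong (lookup ys) eq ⟩
      lookup ys (position j)  ≡⟨ Any.lookup-index (xs⊆ys (∈-lookup j)) ⟨
      lookup xs j             ∎)
    where
    open ≡-Reasoning
    position : Fin (length xs) → Fin (length ys)
    position i = index (xs⊆ys (∈-lookup i))

module CliqueTreeGraph (m : ℕ) where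
  open CliqueTree m

  -- Later arguments need only the inverse laws, so the arithmetic of the coding stays opaque.
  abstract
    Fin↔Vertex : Fin (p + (p * m + p * (m * p))) ↔ Vertex
    Fin↔Vertex = (↔-id _ ⊎-↔ (Fin.*↔× ⊎-↔ (↔-id _ ×-↔ Fin.*↔×) ↔-∘ Fin.*↔×) ↔-∘ Fin.+↔⊎) ↔-∘ Fin.+↔⊎

  open Inverse Fin↔Vertex using () renaming
    (to to decode; from to encode; strictlyInverseˡ to decode-encode; strictlyInverseʳ to encode-decode)

  graph : Graph
  graph = record
    { size = _
    ; adj  = λ u v → ⌊ decode u ~? decode v ⌋
    ; sym  = λ u v → begin
        ⌊ decode u ~? decode v ⌋       ≡⟨ isYes≗does (decode u ~? decode v) ⟩
        does (decode u ~? decode v)    ≡⟨ does-⇔ (mk⇔ ~-sym ~-sym) (decode u ~? decode v) (decode v ~? decode u) ⟩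
        does (decode v ~? decode u)    ≡⟨ isYes≗does (decode v ~? decode u) ⟨
        ⌊ decode v ~? decode u ⌋       ∎
    ; irr  = λ v → trans (isYes≗does (decode v ~? decode v)) (dec-false (decode v ~? decode v) ~-irrefl)
    }
    where open ≡-Reasoning

  neighbours : Fin (size graph) → List (Fin (size graph))
  neighbours v = filter (λ u → T? (adj graph v u)) (allFin _)

  tops : Fin p → Vertex
  tops t = top t

  mids : Fin p → Fin m → Vertex
  mids t i = mid t i

  leaves : Fin p → Fin m → Fin p → Vertex
  leaves t i j = leaf t i j

  -- Including the vertex itself lets whole cliques be tabulated without deleting an entry; degrees
  -- are therefore compared after adding one.
  closedNeighbours : Vertex → List Vertex
  closedNeighbours (top t)      = tabulate (mids t) ++ tabulate tops
  closedNeighbours (mid t i)    = top t ∷ tabulate (mids t) ++ tabulate (leaves t i)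
  closedNeighbours (leaf t i j) = mid t i ∷ tabulate (leaves t i)

  self-∈ : ∀ v → v ∈ closedNeighbours v
  self-∈ (top t)      = ∈-++⁺ʳ (tabulate (mids t)) (∈-tabulate⁺ {f = tops} t)
  self-∈ (mid t i)    = there (∈-++⁺ˡ (∈-tabulate⁺ {f = mids t} i))
  self-∈ (leaf t i j) = there (∈-tabulate⁺ {f = leaves t i} j)

  neighbour-∈ : ∀ {v u} → v ~ u → u ∈ closedNeighbours v
  neighbour-∈ (top-top {t} {t′} _)         = ∈-++⁺ʳ (tabulate (mids t)) (∈-tabulate⁺ {f = tops} t′)
  neighbour-∈ (top-mid {t} {i})            = ∈-++⁺ˡ (∈-tabulate⁺ {f = mids t} i)
  neighbour-∈ mid-top                      = here refl
  neighbour-∈ (mid-mid {t} {i} {i′} _)     = there (∈-++⁺ˡ (∈-tabulate⁺ {f = mids t} i′))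
  neighbour-∈ (mid-leaf {t} {i} {j})       = there (∈-++⁺ʳ (tabulate (mids t)) (∈-tabulate⁺ {f = leaves t i} j))
  neighbour-∈ leaf-mid                     = here refl
  neighbour-∈ (leaf-leaf {t} {i} {j} {j′} _) = there (∈-tabulate⁺ {f = leaves t i} j′)

  length-tabulate-++ : ∀ {a b} (f : Fin a → Vertex) (g : Fin b → Vertex) →
                       length (tabulate f ++ tabulate g) ≡ a + b
  length-tabulate-++ f g =
    trans (length-++ (tabulate f)) (cong₂ _+_ (length-tabulate f) (length-tabulate g))

  length-closedNeighbours : ∀ v → length (closedNeighbours v) ≤ suc (m + p)
  length-closedNeighbours (top t)      = ≤-trans (≤-reflexive (length-tabulate-++ (mids t) tops)) (n≤1+n _)
  length-closedNeighbours (mid t i)    = s≤s (≤-reflexive (length-tabulate-++ (mids t) (leaves t i)))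
  length-closedNeighbours (leaf t i j) = s≤s (≤-trans (≤-reflexive (length-tabulate (leaves t i))) (m≤n+m p m))

  degree≤ : ∀ v → degree graph v ≤ m + p
  degree≤ v = s≤s⁻¹ (begin
    suc (degree graph v)                         ≡⟨ length-map decode (v ∷ neighbours v) ⟨
    length (map decode (v ∷ neighbours v))       ≤⟨ Unique-⊆⇒length≤ unique ⊆closed ⟩
    length (closedNeighbours (decode v))         ≤⟨ length-closedNeighbours (decode v) ⟩
    suc (m + p)                                  ∎)
    where
    open ≤-Reasoning
    adjacent : ∀ {u} → u ∈ neighbours v → decode v ~ decode u
    adjacent {u} u∈ = toWitness {a? = decode v ~? decode u}
      (proj₂ (∈-filter⁻ (λ u → T? (adj graph v u)) {xs = allFin _} u∈))
    unique : Unique (map decode (v ∷ neighbours v))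
    unique = Unique.map⁺ (Injection.injective (↔⇒↣ Fin↔Vertex))
      -- Irreflexivity keeps `v` out of its own list of neighbours, so the list stays free of
      -- repetitions when `v` is added.
      (All.tabulate (λ u∈ v≡u → ~-irrefl (subst (λ u → decode v ~ decode u) (sym v≡u) (adjacent u∈)))
       ∷ Unique.filter⁺ (λ u → T? (adj graph v u)) (Unique.allFin⁺ _))
    ⊆closed : map decode (v ∷ neighbours v) ⊆ closedNeighbours (decode v)
    ⊆closed w∈ with ∈-map⁻ decode w∈
    ... | u , here refl , refl = self-∈ (decode v)
    ... | u , there u∈  , refl = neighbour-∈ (adjacent u∈)

  degree-mid≥ : ∀ t i → m + p ≤ degree graph (encode (mid t i))
  degree-mid≥ t i = s≤s⁻¹ (begin
    suc (m + p)                                        ≡⟨ cong suc (length-tabulate-++ (mids t) (leaves t i)) ⟨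
    length (closedNeighbours (mid t i))                ≡⟨ length-map encode (closedNeighbours (mid t i)) ⟨
    length (map encode (closedNeighbours (mid t i)))   ≤⟨ Unique-⊆⇒length≤ unique closed⊆ ⟩
    suc (degree graph v)                               ∎)
    where
    open ≤-Reasoning
    v = encode (mid t i)
    disjoint : Disjoint (tabulate (mids t)) (tabulate (leaves t i))
    disjoint (u∈ , u∈′) with ∈-tabulate⁻ {f = mids t} u∈ | ∈-tabulate⁻ {f = leaves t i} u∈′
    ... | _ , refl | _ , ()
    unique : Unique (map encode (closedNeighbours (mid t i)))
    unique = Unique.map⁺ (Injection.injective (↔⇒↣ (↔-sym Fin↔Vertex)))
      (All.++⁺ (All.tabulate⁺ {f = mids t} λ _ ()) (All.tabulate⁺ {f = leaves t i} λ _ ())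
       ∷ Unique.++⁺ (Unique.tabulate⁺ λ { refl → refl }) (Unique.tabulate⁺ λ { refl → refl }) disjoint)
    adjacent⇒∈ : ∀ {u} → mid t i ~ u → encode u ∈ v ∷ neighbours v
    adjacent⇒∈ {u} i~u = there (∈-filter⁺ (λ u → T? (adj graph v u)) (∈-allFin _)
      (fromWitness {a? = decode v ~? decode (encode u)}
        (subst₂ _~_ (sym (decode-encode _)) (sym (decode-encode u)) i~u)))
    closed⊆ : map encode (closedNeighbours (mid t i)) ⊆ v ∷ neighbours v
    closed⊆ w∈ with ∈-map⁻ encode w∈
    ... | _ , here refl , refl = adjacent⇒∈ mid-top
    ... | u , there u∈  , refl with ∈-++⁻ (tabulate (mids t)) u∈
    ...   | inj₂ u∈leaves with _ , refl ← ∈-tabulate⁻ {f = leaves t i} u∈leaves = adjacent⇒∈ mid-leaf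
    ...   | inj₁ u∈mids with i′ , refl ← ∈-tabulate⁻ {f = mids t} u∈mids with i Fin.≟ i′
    -- The mid itself is among the tabulated siblings; it matches the added head `v`.
    ...     | yes refl = here refl
    ...     | no i≢i′  = adjacent⇒∈ (mid-mid i≢i′)

  -- The bound on all degrees passes through the fold, and a mid attains it; `m` being positive
  -- makes a mid exist.
  Δ-graph : .{{_ : NonZero m}} → Δ graph ≡ m + p
  Δ-graph = ≤-antisym
    (foldr-preservesᵇ {P = _≤ m + p} ⊔-lub z≤n (All.map⁺ (All.tabulate {xs = allFin _} λ {v} _ → degree≤ v)))
    (foldr-preservesᵒ {P = m + p ≤_} (λ x y → [ m≤n⇒m≤n⊔o y , m≤n⇒m≤o⊔n x ]′) 0 _
      (inj₂ (Any.map⁺ (Any.map (λ { refl → degree-mid≥ t₀ i₀ }) (∈-allFin (encode (mid t₀ i₀)))))))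
    where
    i₀ : Fin m
    i₀ = fromℕ< (>-nonZero⁻¹ m)
    t₀ : Fin p
    t₀ = fromℕ< (>-nonZero⁻¹ p {{m*n≢0 2 m}})

  -- Transfer of both strategies to the encoded graph

  winnable : .{{_ : NonZero m}} → HatWinnable graph (2 * p)
  winnable = strategy , wins
    where
    open Sages m
    strategy : Strategy graph (2 * p)
    strategy = record
      { guess = λ v c → guessV (decode v) (c ∘ encode)
      ; local = λ v c c′ c≈c′ → guessV-local (decode v) λ u v~u →
          c≈c′ (encode u) (fromWitness {a? = decode v ~? decode (encode u)}
            (subst (decode v ~_) (sym (decode-encode u)) v~u))
      }
    wins : Wins graph (2 * p) strategy
    wins c with u , u✓ ← guessV-wins (c ∘ encode) =
      encode u , trans (cong (λ v → guessV v (c ∘ encode)) (decode-encode u)) u✓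

  winnable⇒≤ : ∀ k → HatWinnable graph k → k ≤ 2 * p
  winnable⇒≤ k (strategy , wins) = ≮⇒≥ λ 2p<k →
    let open Adversary 2p<k guessV guessV-local
        v , v✓ = wins (colouring ∘ decode)
    in no-correct-guess (decode v)
         (trans (cong (λ u → guess strategy u (colouring ∘ decode)) (encode-decode v)) v✓)
    where
    guessV : Vertex → (Vertex → Fin k) → Fin k
    guessV v c = guess strategy (encode v) (c ∘ decode)
    guessV-local : Local guessV
    guessV-local v {c} {c′} c≈c′ = local strategy (encode v) _ _ λ u adj-vu →
      c≈c′ (decode u) (subst (_~ decode u) (decode-encode v)
        (toWitness {a? = decode (encode v) ~? decode u} adj-vu))

theorem4p3 : Σ (ℕ → Graph) λ G →
    (∀ M → ∃ λ N → ∀ n → N ≤ n → M ≤ Δ (G n))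
    × (∀ n → 0 < Δ (G n)
    × ∃ λ h → IsHG (G n) h × 3 * h ≡ 4 * Δ (G n))
-- Taking `m = suc n` keeps `m` positive; then `h` is `4 * m` and the maximum degree is `3 * m`.
theorem4p3 = (λ n → graph (suc n)) , unbounded , λ n →
  subst (0 <_) (sym (Δ-graph (suc n))) z<s ,
  2 * (2 * suc n) , (winnable (suc n) , winnable⇒≤ (suc n)) ,
  trans (ratio (suc n)) (cong (4 *_) (sym (Δ-graph (suc n))))
  where
  open CliqueTreeGraph
  ratio : ∀ m → 3 * (2 * (2 * m)) ≡ 4 * (m + 2 * m)
  ratio = solve-∀
  unbounded : ∀ M → ∃ λ N → ∀ n → N ≤ n → M ≤ Δ (graph (suc n))
  unbounded M = M , λ n M≤n → subst (M ≤_) (sym (Δ-graph (suc n)))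
    (≤-trans M≤n (≤-trans (n≤1+n n) (m≤m+n (suc n) (2 * suc n))))
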